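{- (a) Let $\mathcal{M}=(M,\mathit{TRUE},f_\vee,f_\wedge,f_\neg,f_\bot,f_\top,f_\rightarrow,f_\equiv,\preceq)$ be an $\mathit{SCI}$-model (in the Boolean prealgebra sense). Then the pair $\langle\mathcal{A},\mathit{TRUE}\rangle$ with $\mathcal{A}=(M,f_\neg,f_\rightarrow,f_\equiv)$ is a Bloom–Suszko model of $\mathit{SCI}$. (b) Conversely, let $\langle\mathcal{A},B\rangle$ with $\mathcal{A}=(A,f_\neg,f_\rightarrow,f_\equiv)$ be a Bloom–Suszko model of $\mathit{SCI}$. Define $a\preceq b :\Leftrightarrow f_\rightarrow(a,b)\in B$ for $a,b\in A$, and define the additional operations by the usual Boolean equations: $f_\vee(a,b):=f_\rightarrow(f_\neg(a),b)$, $f_\wedge(a,b):=f_\neg(f_\rightarrow(a,f_\neg(b)))$, $f_\top:=f_\rightarrow(a_0,a_0)$ for some fixed $a_0\in A$, and $f_\bot:=f_\neg(f_\top)$. Then $(A,B,f_\vee,f_\wedge,f_\neg,f_\bot,f_\top,f_\rightarrow,f_\equiv,\preceq)$ is an $\mathit{SCI}$-model (in the Boolean prealgebra sense).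
   Context: Boolean prealgebras. A Boolean algebra is regarded as a structure $(B,f_\vee,f_\wedge,f_\neg,f_\bot,f_\top,f_\rightarrow)$ with the usual operations, where $f_\rightarrow(a,b)=f_\vee(f_\neg(a),b)$. A structure $\mathcal{B}=(B,f_\vee,f_\wedge,f_\neg,f_\bot,f_\top,f_\rightarrow,\preceq)$ with operations of arities $(2,2,1,0,0,2)$ and a preorder $\preceq$ on $B$ is a Boolean prealgebra if the relation $a\approx b:\Leftrightarrow(a\preceq b$ and $b\preceq a)$ is a congruence relation for the operations, the quotient $\mathcal{B}/{\approx}$ is a Boolean algebra, and for all $a,b\in B$: $a\preceq b\Leftrightarrow f_\wedge(a,b)\approx a$. A subset $F\subseteq B$ closed under $\approx$ (i.e. $a\approx b$ implies $a\in F\Leftrightarrow b\in F$) is an ultrafilter of $\mathcal{B}$ if $\{\overline{a}\mid a\in F\}$ is an ultrafilter of the Boolean algebra $\mathcal{B}/{\approx}$, where $\overline{a}$ is the $\approx$-class of $a$. $\mathit{SCI}$-model (Boolean prealgebra sense): a structure $(M,\mathit{TRUE},f_\vee,f_\wedge,f_\neg,f_\bot,f_\top,f_\rightarrow,f_\equiv,\preceq)$ such that $(M,f_\vee,f_\wedge,f_\neg,f_\bot,f_\top,f_\rightarrow,\preceq)$ is a Boolean prealgebra, $\mathit{TRUE}\subseteq M$ is an ultrafilter of it, and $f_\equiv$ is a binary function on $M$ with $f_\equiv(m,m')\in\mathit{TRUE}\Leftrightarrow m=m'$ for all $m,m'\in M$. Bloom–Suszko model: Consider formulas built from variables with the connectives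 $\neg,\rightarrow,\equiv$ only. Let $\mathcal{A}=(A,f_\neg,f_\rightarrow,f_\equiv)$ be an algebra of type $(1,2,2)$; a valuation $h$ is a homomorphism from the formula algebra to $\mathcal{A}$. A set $B\subseteq A$ is: closed if $a\in B$ and $f_\rightarrow(a,b)\in B$ imply $b\in B$; proper if $B\neq A$; admissible if for every valuation $h$, $h(\varphi)\in B$ for every axiom $\varphi$, the axioms being all substitution instances of classical tautologies in $\neg,\rightarrow$, and all formulas of the forms $\varphi\equiv\varphi$, $(\varphi\equiv\psi)\rightarrow(\varphi\rightarrow\psi)$, $(\varphi\equiv\psi)\rightarrow(\neg\varphi\equiv\neg\psi)$, and $(\varphi_1\equiv\psi_1)\rightarrow((\varphi_2\equiv\psi_2)\rightarrow((\varphi_1*\varphi_2)\equiv(\psi_1*\psi_2)))$ for $*\in\{\rightarrow,\equiv\}$; a filter if it is closed and admissible; prime if it is proper and for every $a\in A$, $a\in B$ or $f_\neg(a)\in B$; normal if $f_\equiv(a,b)\in B$ implies $a=b$. A Bloom–Suszko model of $\mathit{SCI}$ is a pair $\langle\mathcal{A},B\rangle$ where $B\subseteq A$ is a prime, normal filter. -}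

module Defs where

open import Algebra.Core using (Op₁; Op₂)
open import Algebra.Definitions using (Congruent₁; Congruent₂)
import Algebra.Lattice.Structures as Lattice
open import Data.Bool.Base using (Bool; true; not; _∨_)
open import Data.Nat.Base using (ℕ)
open import Data.Product.Base using (∃-syntax; _×_)
open import Data.Sum.Base using (_⊎_)
open import Function.Bundles using (_⇔_)
open import Level using (Level; _⊔_)
open import Relation.Binary.Construct.Interior.Symmetric using (SymInterior)
open import Relation.Binary.Core using (Rel)
open import Relation.Binary.PropositionalEquality.Core using (_≡_)
open import Relation.Binary.Structures using (IsEquivalence; IsPreorder)
open import Relation.Nullary.Negation.Core using (¬_)
open import Relation.Unary using (Pred; _∈_; Universal)

private
  variable
    a ℓ p r : Level
    A : Set a

------------------------------------------------------------------------
-- Boolean algebras and their ultrafilters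

record BooleanOps (A : Set a) : Set a where
  field
    f∨ : Op₂ A
    f∧ : Op₂ A
    f¬ : Op₁ A
    f⊥ : A
    f⊤ : A
    f→ : Op₂ A

-- There are no quotient types here: the quotient of A by a congruence _≈_ is
-- the setoid (A , _≈_), and a subset of the quotient is a predicate on A that
-- respects _≈_.

module _ {A : Set a} (_≈_ : Rel A ℓ) (ops : BooleanOps A) where

  open BooleanOps ops

  record IsCongruence : Set (a ⊔ ℓ) where
    field
      isEquivalence : IsEquivalence _≈_
      ∨-cong        : Congruent₂ _≈_ f∨
      ∧-cong        : Congruent₂ _≈_ f∧
      ¬-cong        : Congruent₁ _≈_ f¬
      →-cong        : Congruent₂ _≈_ f→

  -- The library's notion does not include implication.
  record IsBooleanAlgebra : Set (a ⊔ ℓ) where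
    field
      isBooleanAlgebra : Lattice.IsBooleanAlgebra _≈_ f∨ f∧ f¬ f⊤ f⊥
      →-def            : ∀ x y → f→ x y ≈ f∨ (f¬ x) y

  -- The lattice order x ≤ y is written out as f∧ x y ≈ x; taking x ≈ y in
  -- `upward` shows that a filter respects _≈_.
  record IsFilter (F : Pred A p) : Set (a ⊔ ℓ ⊔ p) where
    field
      ⊤∈F      : f⊤ ∈ F
      ∧-closed : ∀ {x y} → x ∈ F → y ∈ F → f∧ x y ∈ F
      upward   : ∀ {x y} → x ∈ F → f∧ x y ≈ x → y ∈ F

  record IsUltrafilter (F : Pred A p) : Set (a ⊔ ℓ ⊔ p) where
    field
      isFilter : IsFilter F
      proper   : ¬ Universal F
      ultra    : ∀ x → x ∈ F ⊎ f¬ x ∈ F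

------------------------------------------------------------------------
-- Boolean prealgebras and their ultrafilters

module _ {A : Set a} (ops : BooleanOps A) (_⪯_ : Rel A r) where

  open BooleanOps ops

  private
    -- x ≈ y means x ⪯ y and y ⪯ x.
    _≈_ : Rel A r
    _≈_ = SymInterior _⪯_

  record IsBooleanPrealgebra : Set (a ⊔ r) where
    field
      isPreorder       : IsPreorder _≡_ _⪯_
      isCongruence     : IsCongruence _≈_ ops
      isBooleanAlgebra : IsBooleanAlgebra _≈_ ops
      ⪯⇔∧              : ∀ x y → (x ⪯ y) ⇔ (f∧ x y ≈ x)

  -- The set of classes of elements of F, as a subset of the quotient.
  Classes : Pred A p → Pred A (a ⊔ p ⊔ r)
  Classes F x = ∃[ y ] (y ∈ F × y ≈ x)

  record IsPrealgebraUltrafilter (F : Pred A p) : Set (a ⊔ p ⊔ r) where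
    field
      ≈-closed      : ∀ {x y} → x ≈ y → (x ∈ F) ⇔ (y ∈ F)
      isUltrafilter : IsUltrafilter _≈_ ops (Classes F)

------------------------------------------------------------------------
-- SCI-models in the Boolean prealgebra sense

record IsSCIModel {M : Set a} (TRUE : Pred M p) (ops : BooleanOps M)
                  (f≡ : Op₂ M) (_⪯_ : Rel M r) : Set (a ⊔ p ⊔ r) where
  field
    isBooleanPrealgebra : IsBooleanPrealgebra ops _⪯_
    isUltrafilter       : IsPrealgebraUltrafilter ops _⪯_ TRUE
    f≡-TRUE             : ∀ m m′ → (f≡ m m′ ∈ TRUE) ⇔ (m ≡ m′)

------------------------------------------------------------------------
-- Formulas and axioms of SCI

infix  9 ¬′_
infixr 6 _→′_
infix  7 _≡′_

data Formula : Set where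
  var  : ℕ → Formula
  ¬′_  : Formula → Formula
  _→′_ : Formula → Formula → Formula
  _≡′_ : Formula → Formula → Formula

data Classical : Set where
  var : ℕ → Classical
  neg : Classical → Classical
  imp : Classical → Classical → Classical

eval : (ℕ → Bool) → Classical → Bool
eval v (var n)   = v n
eval v (neg φ)   = not (eval v φ)
eval v (imp φ ψ) = not (eval v φ) ∨ eval v ψ

Tautology : Classical → Set
Tautology φ = ∀ v → eval v φ ≡ true

substitute : (ℕ → Formula) → Classical → Formula
substitute σ (var n)   = σ n
substitute σ (neg φ)   = ¬′ substitute σ φ
substitute σ (imp φ ψ) = substitute σ φ →′ substitute σ ψ

data Axiom : Formula → Set where
  tautology : ∀ {φ} → Tautology φ → ∀ σ → Axiom (substitute σ φ)
  ≡-refl    : ∀ φ → Axiom (φ ≡′ φ)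
  ≡-elim    : ∀ φ ψ → Axiom ((φ ≡′ ψ) →′ (φ →′ ψ))
  ≡-¬       : ∀ φ ψ → Axiom ((φ ≡′ ψ) →′ ((¬′ φ) ≡′ (¬′ ψ)))
  ≡-→       : ∀ φ₁ ψ₁ φ₂ ψ₂ →
              Axiom ((φ₁ ≡′ ψ₁) →′ ((φ₂ ≡′ ψ₂) →′
                     ((φ₁ →′ φ₂) ≡′ (ψ₁ →′ ψ₂))))
  ≡-≡       : ∀ φ₁ ψ₁ φ₂ ψ₂ →
              Axiom ((φ₁ ≡′ ψ₁) →′ ((φ₂ ≡′ ψ₂) →′
                     ((φ₁ ≡′ φ₂) ≡′ (ψ₁ ≡′ ψ₂))))

------------------------------------------------------------------------
-- Bloom–Suszko models

record SCIAlgebra (A : Set a) : Set a where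
  field
    f¬ : Op₁ A
    f→ : Op₂ A
    f≡ : Op₂ A

module _ {A : Set a} (𝒜 : SCIAlgebra A) where

  open SCIAlgebra 𝒜

  record IsValuation (h : Formula → A) : Set a where
    field
      ¬-homo : ∀ φ → h (¬′ φ) ≡ f¬ (h φ)
      →-homo : ∀ φ ψ → h (φ →′ ψ) ≡ f→ (h φ) (h ψ)
      ≡-homo : ∀ φ ψ → h (φ ≡′ ψ) ≡ f≡ (h φ) (h ψ)

  module _ (B : Pred A p) where

    Closed : Set _
    Closed = ∀ {x y} → x ∈ B → f→ x y ∈ B → y ∈ B

    Admissible : Set _
    Admissible = ∀ h → IsValuation h → ∀ {φ} → Axiom φ → h φ ∈ B

    Proper : Set _
    Proper = ¬ Universal B

    Normal : Set _
    Normal = ∀ {x y} → f≡ x y ∈ B → x ≡ y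

    record IsBSFilter : Set (a ⊔ p) where
      field
        closed     : Closed
        admissible : Admissible

    record IsPrime : Set (a ⊔ p) where
      field
        proper : Proper
        prime  : ∀ x → x ∈ B ⊎ f¬ x ∈ B

    record IsBloomSuszkoModel : Set (a ⊔ p) where
      field
        isFilter : IsBSFilter
        isPrime  : IsPrime
        normal   : Normal

------------------------------------------------------------------------
-- Passing between the two signatures

sciReduct : BooleanOps A → Op₂ A → SCIAlgebra A
sciReduct ops f≡ = record { f¬ = f¬ ; f→ = f→ ; f≡ = f≡ }
  where open BooleanOps ops

definedOps : SCIAlgebra A → A → BooleanOps A
definedOps 𝒜 a₀ = record
  { f∨ = λ x y → f→ (f¬ x) y
  ; f∧ = λ x y → f¬ (f→ x (f¬ y))
  ; f¬ = f¬
  ; f⊥ = f¬ (f→ a₀ a₀)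
  ; f⊤ = f→ a₀ a₀
  ; f→ = f→
  }
  where open SCIAlgebra 𝒜

definedPreorder : SCIAlgebra A → Pred A p → Rel A p
definedPreorder 𝒜 B x y = f→ x y ∈ B
  where open SCIAlgebra 𝒜

{-# OPTIONS --safe #-}
-- A prime filter B splits the elements of a model into true and false ones in
-- a way that the connectives respect: membership in B is a {¬, →}-homomorphism
-- to the two-element Boolean algebra. Both kinds of model give such a
-- homomorphism, from the ultrafilter laws in (a) and from two
-- tautologies in (b). In (a) it maps every tautology to true, and the axioms
-- for ≡ hold because elements identified by f≡ are equal. In (b), a ⪯ b says
-- that b is true if a is, so the quotient by ≈ embeds into the two-element
-- Boolean algebra and inherits its laws.
module Submission where

open import Defs
open import Algebra.Core using (Op₁; Op₂)
open import Algebra.Definitions using (Congruent₁; Congruent₂)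
open import Algebra.Lattice.Bundles using (BooleanAlgebra)
import Algebra.Lattice.Morphism.LatticeMonomorphism as LatticeMonomorphism
open import Algebra.Lattice.Morphism.Structures using (IsLatticeMonomorphism)
import Algebra.Lattice.Properties.BooleanAlgebra as BooleanAlgebraProperties
import Algebra.Lattice.Structures as Lattice
open import Data.Bool.Base using (Bool; true; false; not; _∧_; _∨_)
import Data.Bool.Properties as Bool
open import Data.Nat.Base using (ℕ; zero; suc)
open import Data.Product.Base using (_×_; _,_; proj₁; proj₂)
open import Data.Sum.Base using (_⊎_; inj₁; inj₂; [_,_]; map)
open import Function.Base using (id; _∘_)
open import Function.Bundles using (_⇔_; mk⇔; Equivalence)
open import Level using (Level; _⊔_)
import Relation.Binary.Construct.Interior.Symmetric as SymInterior
open SymInterior using (SymInterior; _,_)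
open import Relation.Binary.Core using (Rel)
open import Relation.Binary.Definitions using (Reflexive)
open import Relation.Binary.PropositionalEquality
  using (_≡_; refl; sym; trans; cong; cong₂; subst; isEquivalence)
open import Relation.Binary.Structures using (IsPreorder)
import Relation.Binary.Reasoning.Setoid as ≈-Reasoning
open import Relation.Nullary.Decidable
  using (yes; no; does; does-⇔; dec-true; ¬?; _→-dec_; _×-dec_; _⊎-dec_)
open import Relation.Nullary.Negation using (¬_; contradiction)
open import Relation.Unary using (Pred; _∈_; _⊆_; Decidable)

open Equivalence using (to; from)

private
  variable
    a ℓ p q r : Level
    A : Set a

-- Two-valued subsets and their truth function

record IsTwoValued {A : Set a} (f¬ : Op₁ A) (f→ : Op₂ A) (B : Pred A p) :
                   Set (a ⊔ p) where
  field
    -- The clauses are the truth tables: the first two for negation, the other three for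
    -- implication. The disjunction in `complete` is what makes membership decidable.
    complete     : ∀ x → x ∈ B ⊎ f¬ x ∈ B
    consistent   : ∀ {x} → x ∈ B → ¬ (f¬ x ∈ B)
    modusPonens  : ∀ {x y} → x ∈ B → f→ x y ∈ B → y ∈ B
    →-consequent : ∀ {x y} → y ∈ B → f→ x y ∈ B
    →-antecedent : ∀ {x y} → f¬ x ∈ B → f→ x y ∈ B

  _∈?B : Decidable B
  x ∈?B = [ yes , (λ ¬x∈B → no (λ x∈B → consistent x∈B ¬x∈B)) ] (complete x)

  ¬-intro : ∀ {x} → ¬ (x ∈ B) → f¬ x ∈ B
  ¬-intro {x} x∉B = [ (λ x∈B → contradiction x∈B x∉B) , id ] (complete x)

  →-intro : ∀ {x y} → (x ∈ B → y ∈ B) → f→ x y ∈ B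
  →-intro {x} x⇒y = [ →-consequent ∘ x⇒y , →-antecedent ] (complete x)

  truth : A → Bool
  truth x = does (x ∈?B)

  ∈⇒truth : ∀ {x} → x ∈ B → truth x ≡ true
  ∈⇒truth {x} = dec-true (x ∈?B)

  truth⇒∈ : ∀ {x} → truth x ≡ true → x ∈ B
  truth⇒∈ {x} eq with x ∈?B
  ... | yes x∈B = x∈B
  truth⇒∈ {x} () | no _

  -- An equivalence of propositions becomes an equation of Booleans: `does` of the compound decision
  -- `¬?` computes to `not`. The other connectives are treated in the same way.
  truth-¬ : ∀ x → truth (f¬ x) ≡ not (truth x)
  truth-¬ x = does-⇔ (mk⇔ (λ ¬x∈B x∈B → consistent x∈B ¬x∈B) ¬-intro)
                     (f¬ x ∈?B) (¬? (x ∈?B))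

  truth-→ : ∀ x y → truth (f→ x y) ≡ not (truth x) ∨ truth y
  truth-→ x y = does-⇔ (mk⇔ (λ xy∈B x∈B → modusPonens x∈B xy∈B) →-intro)
                       (f→ x y ∈?B) ((x ∈?B) →-dec (y ∈?B))

module _ {f¬ : Op₁ A} {f→ : Op₂ A} {F : Pred A p} {G : Pred A q} where

  -- Needed to move from the classes of `TRUE`, where the ultrafilter laws are stated, back to
  -- `TRUE` itself.
  isTwoValued-resp : F ⊆ G → G ⊆ F →
                     IsTwoValued f¬ f→ F → IsTwoValued f¬ f→ G
  isTwoValued-resp F⊆G G⊆F two = record
    { complete     = map F⊆G F⊆G ∘ complete
    ; consistent   = λ x∈G ¬x∈G → consistent (G⊆F x∈G) (G⊆F ¬x∈G)
    ; modusPonens  = λ x∈G xy∈G → F⊆G (modusPonens (G⊆F x∈G) (G⊆F xy∈G))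
    ; →-consequent = F⊆G ∘ →-consequent ∘ G⊆F
    ; →-antecedent = F⊆G ∘ →-antecedent ∘ G⊆F
    } where open IsTwoValued two

-- Ultrafilters of Boolean algebras are two-valued

module _ {_≈_ : Rel A ℓ} {ops : BooleanOps A} {F : Pred A p}
         (isBA : IsBooleanAlgebra _≈_ ops) where

  open BooleanOps ops
  open IsBooleanAlgebra isBA

  private
    booleanAlgebra : BooleanAlgebra _ _
    booleanAlgebra = record { isBooleanAlgebra = isBooleanAlgebra }

    module BA = BooleanAlgebra booleanAlgebra
    module BAP = BooleanAlgebraProperties booleanAlgebra

  open ≈-Reasoning BA.setoid

  -- The meet of an element and its complement is bottom. The shape is the order relation that
  -- `upward` expects, so a filter containing both `x` and `f¬ x` contains every `y`.
  contradiction-least : ∀ x y → f∧ (f∧ x (f¬ x)) y ≈ f∧ x (f¬ x)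
  contradiction-least x y = begin
    f∧ (f∧ x (f¬ x)) y  ≈⟨ BA.∧-congʳ (BA.∧-complementʳ x) ⟩
    f∧ f⊥ y             ≈⟨ BAP.∧-zeroˡ y ⟩
    f⊥                  ≈⟨ BA.∧-complementʳ x ⟨
    f∧ x (f¬ x)         ∎

  -- Distributing `x` over `f∨ (f¬ x) y` leaves only the second summand, the first being bottom.
  ∧-→-collapse : ∀ x y → f∧ x (f→ x y) ≈ f∧ x y
  ∧-→-collapse x y = begin
    f∧ x (f→ x y)                ≈⟨ BA.∧-congˡ (→-def x y) ⟩
    f∧ x (f∨ (f¬ x) y)           ≈⟨ BA.∧-distribˡ-∨ x (f¬ x) y ⟩
    f∨ (f∧ x (f¬ x)) (f∧ x y)    ≈⟨ BA.∨-congʳ (BA.∧-complementʳ x) ⟩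
    f∨ f⊥ (f∧ x y)               ≈⟨ BAP.∨-identityˡ (f∧ x y) ⟩
    f∧ x y                       ∎

  modusPonens-≤ : ∀ x y → f∧ (f∧ x (f→ x y)) y ≈ f∧ x (f→ x y)
  modusPonens-≤ x y = begin
    f∧ (f∧ x (f→ x y)) y  ≈⟨ BA.∧-congʳ (∧-→-collapse x y) ⟩
    f∧ (f∧ x y) y         ≈⟨ BA.∧-assoc x y y ⟩
    f∧ x (f∧ y y)         ≈⟨ BA.∧-congˡ (BAP.∧-idem y) ⟩
    f∧ x y                ≈⟨ ∧-→-collapse x y ⟨
    f∧ x (f→ x y)         ∎

  consequent-≤ : ∀ x y → f∧ y (f→ x y) ≈ y
  consequent-≤ x y = begin
    f∧ y (f→ x y)       ≈⟨ BA.∧-congˡ (→-def x y) ⟩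
    f∧ y (f∨ (f¬ x) y)  ≈⟨ BA.∧-congˡ (BA.∨-comm (f¬ x) y) ⟩
    f∧ y (f∨ y (f¬ x))  ≈⟨ BA.∧-absorbs-∨ y (f¬ x) ⟩
    y                   ∎

  antecedent-≤ : ∀ x y → f∧ (f¬ x) (f→ x y) ≈ f¬ x
  antecedent-≤ x y = begin
    f∧ (f¬ x) (f→ x y)       ≈⟨ BA.∧-congˡ (→-def x y) ⟩
    f∧ (f¬ x) (f∨ (f¬ x) y)  ≈⟨ BA.∧-absorbs-∨ (f¬ x) y ⟩
    f¬ x                     ∎

  ultrafilter⇒twoValued : IsUltrafilter _≈_ ops F → IsTwoValued f¬ f→ F
  ultrafilter⇒twoValued isUltrafilter = record
    { complete     = ultra
    ; consistent   = λ {x} x∈F ¬x∈F → proper λ y →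
                       upward (∧-closed x∈F ¬x∈F) (contradiction-least x y)
    ; modusPonens  = λ {x} {y} x∈F xy∈F →
                       upward (∧-closed x∈F xy∈F) (modusPonens-≤ x y)
    ; →-consequent = λ {x} {y} y∈F → upward y∈F (consequent-≤ x y)
    ; →-antecedent = λ {x} {y} ¬x∈F → upward ¬x∈F (antecedent-≤ x y)
    } where open IsUltrafilter isUltrafilter
            open IsFilter isFilter

-- Subsets and their sets of classes

module _ {ops : BooleanOps A} {_⪯_ : Rel A r} {F : Pred A p} where

  ⊆Classes : Reflexive _⪯_ → F ⊆ Classes ops _⪯_ F
  ⊆Classes ⪯-refl {x} x∈F = x , x∈F , SymInterior.reflexive ⪯-refl

  Classes⊆ : (∀ {x y} → SymInterior _⪯_ x y → (x ∈ F) ⇔ (y ∈ F)) →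
             Classes ops _⪯_ F ⊆ F
  Classes⊆ ≈-closed (_ , y∈F , y≈x) = to (≈-closed y≈x) y∈F

-- From Boolean prealgebras to Bloom–Suszko models

module _ {𝒜 : SCIAlgebra A} {B : Pred A p} where

  open SCIAlgebra 𝒜

  module _ (two : IsTwoValued f¬ f→ B)
           (f≡⇔≡ : ∀ x y → (f≡ x y ∈ B) ⇔ (x ≡ y))
           {h : Formula → A} (isValuation : IsValuation 𝒜 h) where

    open IsTwoValued two
    open IsValuation isValuation

    -- Since `truth ∘ h` respects negation and implication, the truth value of a substitution
    -- instance depends only on the truth values of the formulas put in for the variables.
    truth-substitute : ∀ σ φ →
                       truth (h (substitute σ φ)) ≡ eval (truth ∘ h ∘ σ) φ
    truth-substitute σ (var n)   = refl
    truth-substitute σ (neg φ)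
      rewrite ¬-homo (substitute σ φ)
            | truth-¬ (h (substitute σ φ))
            | truth-substitute σ φ = refl
    truth-substitute σ (imp φ ψ)
      rewrite →-homo (substitute σ φ) (substitute σ ψ)
            | truth-→ (h (substitute σ φ)) (h (substitute σ ψ))
            | truth-substitute σ φ
            | truth-substitute σ ψ = refl

    ≡⇒∈ : ∀ {x y} → x ≡ y → f≡ x y ∈ B
    ≡⇒∈ = from (f≡⇔≡ _ _)

    ∈⇒≡ : ∀ {x y} → f≡ x y ∈ B → x ≡ y
    ∈⇒≡ = to (f≡⇔≡ _ _)

    axiom∈ : ∀ {φ} → Axiom φ → h φ ∈ B
    axiom∈ (tautology {φ} taut σ) =
      truth⇒∈ (trans (truth-substitute σ φ) (taut (truth ∘ h ∘ σ)))
    axiom∈ (≡-refl φ) rewrite ≡-homo φ φ = ≡⇒∈ refl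
    -- In this and the remaining cases the rewrites push `h` inwards through the connectives. A true
    -- `f≡` premise is then an actual equality, along which one substitutes or applies congruence.
    axiom∈ (≡-elim φ ψ)
      rewrite →-homo (φ ≡′ ψ) (φ →′ ψ) | ≡-homo φ ψ | →-homo φ ψ =
      →-intro λ φ≡ψ → →-intro (subst (_∈ B) (∈⇒≡ φ≡ψ))
    axiom∈ (≡-¬ φ ψ)
      rewrite →-homo (φ ≡′ ψ) ((¬′ φ) ≡′ (¬′ ψ)) | ≡-homo φ ψ
            | ≡-homo (¬′ φ) (¬′ ψ) | ¬-homo φ | ¬-homo ψ =
      →-intro (≡⇒∈ ∘ cong f¬ ∘ ∈⇒≡)
    axiom∈ (≡-→ φ₁ ψ₁ φ₂ ψ₂)
      rewrite →-homo (φ₁ ≡′ ψ₁)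
                     ((φ₂ ≡′ ψ₂) →′ ((φ₁ →′ φ₂) ≡′ (ψ₁ →′ ψ₂)))
            | →-homo (φ₂ ≡′ ψ₂) ((φ₁ →′ φ₂) ≡′ (ψ₁ →′ ψ₂))
            | ≡-homo φ₁ ψ₁ | ≡-homo φ₂ ψ₂
            | ≡-homo (φ₁ →′ φ₂) (ψ₁ →′ ψ₂)
            | →-homo φ₁ φ₂ | →-homo ψ₁ ψ₂ =
      →-intro λ e₁ → →-intro λ e₂ → ≡⇒∈ (cong₂ f→ (∈⇒≡ e₁) (∈⇒≡ e₂))
    axiom∈ (≡-≡ φ₁ ψ₁ φ₂ ψ₂)
      rewrite →-homo (φ₁ ≡′ ψ₁)
                     ((φ₂ ≡′ ψ₂) →′ ((φ₁ ≡′ φ₂) ≡′ (ψ₁ ≡′ ψ₂)))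
            | →-homo (φ₂ ≡′ ψ₂) ((φ₁ ≡′ φ₂) ≡′ (ψ₁ ≡′ ψ₂))
            | ≡-homo φ₁ ψ₁ | ≡-homo φ₂ ψ₂
            | ≡-homo (φ₁ ≡′ φ₂) (ψ₁ ≡′ ψ₂)
            | ≡-homo φ₁ φ₂ | ≡-homo ψ₁ ψ₂ =
      →-intro λ e₁ → →-intro λ e₂ → ≡⇒∈ (cong₂ f≡ (∈⇒≡ e₁) (∈⇒≡ e₂))

sciModel⇒bloomSuszko :
  ∀ {TRUE : Pred A p} {ops : BooleanOps A} {f≡ : Op₂ A} {_⪯_ : Rel A r} →
  IsSCIModel TRUE ops f≡ _⪯_ → IsBloomSuszkoModel (sciReduct ops f≡) TRUE
sciModel⇒bloomSuszko {TRUE = TRUE} {ops} {f≡} {_⪯_} model = record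
  { isFilter = record
    { closed     = modusPonens
    ; admissible = λ h isValuation → axiom∈ two f≡-TRUE isValuation
    }
  ; isPrime  = record
    -- Any element would serve as witness; `f⊤` is one that is at hand.
    { proper = λ TRUE-universal →
                 consistent (TRUE-universal f⊤) (TRUE-universal (f¬ f⊤))
    ; prime  = complete
    }
  ; normal   = to (f≡-TRUE _ _)
  }
  where
  open BooleanOps ops
  open IsSCIModel model
  open IsBooleanPrealgebra isBooleanPrealgebra using (isPreorder; isBooleanAlgebra)
  open IsPrealgebraUltrafilter isUltrafilter
    using (≈-closed) renaming (isUltrafilter to isUltrafilter/≈)

  two : IsTwoValued f¬ f→ TRUE
  two = isTwoValued-resp
    (Classes⊆ {ops = ops} ≈-closed)
    (⊆Classes {ops = ops} {_⪯_ = _⪯_} (IsPreorder.refl isPreorder))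
    (ultrafilter⇒twoValued isBooleanAlgebra isUltrafilter/≈)

  open IsTwoValued two

-- From Bloom–Suszko models to Boolean prealgebras

module _ (𝒜 : SCIAlgebra A) where

  open SCIAlgebra 𝒜

  -- The homomorphic extension of an assignment. `admissible` speaks only of homomorphisms, so this
  -- is how axioms are instantiated at chosen elements.
  ⟦_⟧ : Formula → (ℕ → A) → A
  ⟦ var n ⟧   ρ = ρ n
  ⟦ ¬′ φ ⟧    ρ = f¬ (⟦ φ ⟧ ρ)
  ⟦ φ →′ ψ ⟧ ρ = f→ (⟦ φ ⟧ ρ) (⟦ ψ ⟧ ρ)
  ⟦ φ ≡′ ψ ⟧ ρ = f≡ (⟦ φ ⟧ ρ) (⟦ ψ ⟧ ρ)

  ⟦⟧-isValuation : ∀ ρ → IsValuation 𝒜 (λ φ → ⟦ φ ⟧ ρ)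
  ⟦⟧-isValuation ρ = record
    { ¬-homo = λ _ → refl
    ; →-homo = λ _ _ → refl
    ; ≡-homo = λ _ _ → refl
    }

module _ {𝒜 : SCIAlgebra A} {B : Pred A p}
         (model : IsBloomSuszkoModel 𝒜 B) where

  open SCIAlgebra 𝒜
  open IsBloomSuszkoModel model
  open IsBSFilter isFilter
  open IsPrime isPrime

  axiom-holds : ∀ {φ} → Axiom φ → ∀ ρ → ⟦_⟧ 𝒜 φ ρ ∈ B
  axiom-holds axiom ρ = admissible _ (⟦⟧-isValuation 𝒜 ρ) axiom

  -- Variable 0 is sent to `x` and every other variable to `y`, which suffices for the two
  -- tautologies below.
  tautology₂ : ∀ {φ} → Tautology φ → ∀ x y →
               ⟦_⟧ 𝒜 (substitute var φ) (λ { zero → x ; (suc _) → y }) ∈ B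
  tautology₂ {φ} taut x y = axiom-holds (tautology {φ} taut var) _

  consequent-tautology : Tautology (imp (var 1) (imp (var 0) (var 1)))
  consequent-tautology v with v 0 | v 1
  ... | _     | false = refl
  ... | false | true  = refl
  ... | true  | true  = refl

  antecedent-tautology : Tautology (imp (neg (var 0)) (imp (var 0) (var 1)))
  antecedent-tautology v with v 0
  ... | false = refl
  ... | true  = refl

  weaken : ∀ {x y} → y ∈ B → f→ x y ∈ B
  weaken {x} {y} y∈B = closed y∈B
    (tautology₂ {imp (var 1) (imp (var 0) (var 1))} consequent-tautology x y)

  exFalso : ∀ {x y} → f¬ x ∈ B → f→ x y ∈ B
  exFalso {x} {y} ¬x∈B = closed ¬x∈B
    (tautology₂ {imp (neg (var 0)) (imp (var 0) (var 1))}
                antecedent-tautology x y)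

  bloomSuszko⇒twoValued : IsTwoValued f¬ f→ B
  bloomSuszko⇒twoValued = record
    { complete     = prime
    -- Explosion: a contradictory pair in `B` would put every `y` into `B`.
    ; consistent   = λ x∈B ¬x∈B → proper λ y → closed x∈B (exFalso ¬x∈B)
    ; modusPonens  = closed
    ; →-consequent = weaken
    ; →-antecedent = exFalso
    }

  f≡-refl : ∀ x → f≡ x x ∈ B
  f≡-refl x = axiom-holds (≡-refl (var 0)) (λ _ → x)

-- The Boolean prealgebra and ultrafilter given by a two-valued set

module _ (𝒜 : SCIAlgebra A) {B : Pred A p} (a₀ : A)
         (two : IsTwoValued (SCIAlgebra.f¬ 𝒜) (SCIAlgebra.f→ 𝒜) B) where

  open IsTwoValued two

  private
    ops : BooleanOps A
    ops = definedOps 𝒜 a₀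

    _⪯_ _≈_ : Rel A _
    _⪯_ = definedPreorder 𝒜 B
    _≈_ = SymInterior _⪯_

  open BooleanOps ops

  ∨-⇔ : ∀ x y → (f∨ x y ∈ B) ⇔ (x ∈ B ⊎ y ∈ B)
  ∨-⇔ x y = mk⇔
    (λ xy∈B → [ inj₁ , (λ ¬x∈B → inj₂ (modusPonens ¬x∈B xy∈B)) ] (complete x))
    [ (λ x∈B → →-intro λ ¬x∈B → contradiction ¬x∈B (consistent x∈B))
    , →-consequent ]

  ∧-⇔ : ∀ x y → (f∧ x y ∈ B) ⇔ (x ∈ B × y ∈ B)
  ∧-⇔ x y = mk⇔
    -- Here `xy∈B` is the negation of `f→ x (f¬ y)`, and that implication would hold if `x` or `y`
    -- were false.
    (λ xy∈B → [ id , (λ ¬x∈B → refuted xy∈B (→-antecedent ¬x∈B)) ] (complete x)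
            , [ id , (λ ¬y∈B → refuted xy∈B (→-consequent ¬y∈B)) ] (complete y))
    (λ (x∈B , y∈B) → ¬-intro λ x→¬y∈B → consistent y∈B (modusPonens x∈B x→¬y∈B))
    where
    refuted : ∀ {z w} → f¬ z ∈ B → z ∈ B → w ∈ B
    refuted ¬z∈B z∈B = contradiction ¬z∈B (consistent z∈B)

  truth-∨ : ∀ x y → truth (f∨ x y) ≡ truth x ∨ truth y
  truth-∨ x y = does-⇔ (∨-⇔ x y) (f∨ x y ∈?B) ((x ∈?B) ⊎-dec (y ∈?B))

  truth-∧ : ∀ x y → truth (f∧ x y) ≡ truth x ∧ truth y
  truth-∧ x y = does-⇔ (∧-⇔ x y) (f∧ x y ∈?B) ((x ∈?B) ×-dec (y ∈?B))

  ⊤∈B : f⊤ ∈ B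
  ⊤∈B = →-intro id

  truth-⊤ : truth f⊤ ≡ true
  truth-⊤ = ∈⇒truth ⊤∈B

  truth-⊥ : truth f⊥ ≡ false
  truth-⊥ = trans (truth-¬ f⊤) (cong not truth-⊤)

  truth⇒⪯ : ∀ {x y} → truth x ≡ truth y → x ⪯ y
  truth⇒⪯ eq = →-intro λ x∈B → truth⇒∈ (trans (sym eq) (∈⇒truth x∈B))

  -- Elements of equal truth value imply each other. This is injectivity of `truth` on the quotient,
  -- through which Boolean identities are pulled back to `_≈_`.
  truth⇒≈ : ∀ {x y} → truth x ≡ truth y → x ≈ y
  truth⇒≈ eq = truth⇒⪯ eq , truth⇒⪯ (sym eq)

  ≈⇒⇔ : ∀ {x y} → x ≈ y → (x ∈ B) ⇔ (y ∈ B)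
  ≈⇒⇔ (x⪯y , y⪯x) = mk⇔ (λ x∈B → modusPonens x∈B x⪯y)
                        (λ y∈B → modusPonens y∈B y⪯x)

  ≈⇒truth : ∀ {x y} → x ≈ y → truth x ≡ truth y
  ≈⇒truth {x} {y} x≈y = does-⇔ (≈⇒⇔ x≈y) (x ∈?B) (y ∈?B)

  ⪯-refl : ∀ {x} → x ⪯ x
  ⪯-refl = →-intro id

  ⪯-trans : ∀ {x y z} → x ⪯ y → y ⪯ z → x ⪯ z
  ⪯-trans x⪯y y⪯z = →-intro λ x∈B → modusPonens (modusPonens x∈B x⪯y) y⪯z

  definedPreorder-isPreorder : IsPreorder _≡_ _⪯_
  definedPreorder-isPreorder = record
    { isEquivalence = isEquivalence
    ; reflexive     = λ { refl → ⪯-refl }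
    ; trans         = ⪯-trans
    }

  ¬-cong : Congruent₁ _≈_ f¬
  ¬-cong {x} {y} x≈y = truth⇒≈
    (trans (truth-¬ x) (trans (cong not (≈⇒truth x≈y)) (sym (truth-¬ y))))

  →-cong : Congruent₂ _≈_ f→
  →-cong {x} {y} {u} {v} x≈y u≈v = truth⇒≈
    (trans (truth-→ x u)
      (trans (cong₂ (λ b c → not b ∨ c) (≈⇒truth x≈y) (≈⇒truth u≈v))
        (sym (truth-→ y v))))

  truth-isLatticeMonomorphism : IsLatticeMonomorphism
    (record { _≈_ = _≈_ ; _∧_ = f∧ ; _∨_ = f∨ })
    (record { _≈_ = _≡_ ; _∧_ = _∧_ ; _∨_ = _∨_ })
    truth
  truth-isLatticeMonomorphism = record
    { isLatticeHomomorphism = record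
      { isRelHomomorphism = record { cong = ≈⇒truth }
      ; ∧-homo            = truth-∧
      ; ∨-homo            = truth-∨
      }
    ; injective             = truth⇒≈
    }

  definedOps-isLatticeBooleanAlgebra :
    Lattice.IsBooleanAlgebra _≈_ f∨ f∧ f¬ f⊤ f⊥
  definedOps-isLatticeBooleanAlgebra = record
    { isDistributiveLattice = LatticeMonomorphism.isDistributiveLattice
        truth-isLatticeMonomorphism Bool.∨-∧-isDistributiveLattice
    -- Complements lie outside the lattice signature, so their laws are pulled back one by one.
    ; ∨-complement = (λ x → truth⇒≈ (∨-complementˡ x))
                   , (λ x → truth⇒≈ (∨-complementʳ x))
    ; ∧-complement = (λ x → truth⇒≈ (∧-complementˡ x))
                   , (λ x → truth⇒≈ (∧-complementʳ x))
    ; ¬-cong       = ¬-cong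
    }
    where
    ∨-complementˡ : ∀ x → truth (f∨ (f¬ x) x) ≡ truth f⊤
    ∨-complementˡ x rewrite truth-∨ (f¬ x) x | truth-¬ x | truth-⊤ =
      Bool.∨-inverseˡ (truth x)

    ∨-complementʳ : ∀ x → truth (f∨ x (f¬ x)) ≡ truth f⊤
    ∨-complementʳ x rewrite truth-∨ x (f¬ x) | truth-¬ x | truth-⊤ =
      Bool.∨-inverseʳ (truth x)

    ∧-complementˡ : ∀ x → truth (f∧ (f¬ x) x) ≡ truth f⊥
    ∧-complementˡ x rewrite truth-∧ (f¬ x) x | truth-¬ x | truth-⊥ =
      Bool.∧-inverseˡ (truth x)

    ∧-complementʳ : ∀ x → truth (f∧ x (f¬ x)) ≡ truth f⊥
    ∧-complementʳ x rewrite truth-∧ x (f¬ x) | truth-¬ x | truth-⊥ =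
      Bool.∧-inverseʳ (truth x)

  definedOps-→-def : ∀ x y → f→ x y ≈ f∨ (f¬ x) y
  definedOps-→-def x y =
    truth⇒≈ (trans (truth-→ x y)
      (sym (trans (truth-∨ (f¬ x) y) (cong (_∨ truth y) (truth-¬ x)))))

  definedOps-isBooleanPrealgebra : IsBooleanPrealgebra ops _⪯_
  definedOps-isBooleanPrealgebra = record
    { isPreorder       = definedPreorder-isPreorder
    ; isCongruence     = record
      { isEquivalence = BA.isEquivalence
      ; ∨-cong        = BA.∨-cong
      ; ∧-cong        = BA.∧-cong
      ; ¬-cong        = ¬-cong
      ; →-cong        = →-cong
      }
    ; isBooleanAlgebra = record
      { isBooleanAlgebra = definedOps-isLatticeBooleanAlgebra
      ; →-def            = definedOps-→-def
      }
    -- As `f∧ x y` always implies `x`, the content is that `x ⪯ y` holds exactly when `x` implies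
    -- `f∧ x y`.
    ; ⪯⇔∧              = λ x y → mk⇔
        (λ x⪯y → →-intro (proj₁ ∘ to (∧-⇔ x y))
               , →-intro (λ x∈B → from (∧-⇔ x y) (x∈B , modusPonens x∈B x⪯y)))
        (λ (_ , x⪯xy) →
           →-intro λ x∈B → proj₂ (to (∧-⇔ x y) (modusPonens x∈B x⪯xy)))
    }
    where
    module BA = Lattice.IsBooleanAlgebra definedOps-isLatticeBooleanAlgebra

  twoValued-isUltrafilter : IsPrealgebraUltrafilter ops _⪯_ B
  twoValued-isUltrafilter = record
    { ≈-closed      = ≈⇒⇔
    ; isUltrafilter = record
      { isFilter = record
        { ⊤∈F      = class ⊤∈B
        ; ∧-closed = λ x∈C y∈C →
                       class (from (∧-⇔ _ _) (unclass x∈C , unclass y∈C))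
        -- Membership of `x` is carried across `xy≈x` to the meet, whose second component is then in
        -- `B`.
        ; upward   = λ x∈C xy≈x → class
            (proj₂ (to (∧-⇔ _ _) (from (≈⇒⇔ xy≈x) (unclass x∈C))))
        }
      -- The element outside `B` is `f⊥`, by definition the negation of `f⊤`.
      ; proper   = λ universal →
                     consistent ⊤∈B (unclass (universal f⊥))
      ; ultra    = map class class ∘ complete
      }
    }
    where
    class : B ⊆ Classes ops _⪯_ B
    class = ⊆Classes {ops = ops} {_⪯_ = _⪯_} ⪯-refl

    unclass : Classes ops _⪯_ B ⊆ B
    unclass = Classes⊆ {ops = ops} ≈⇒⇔

bloomSuszko⇒sciModel :
  ∀ {𝒜 : SCIAlgebra A} {B : Pred A p} → IsBloomSuszkoModel 𝒜 B → ∀ a₀ →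
  IsSCIModel B (definedOps 𝒜 a₀) (SCIAlgebra.f≡ 𝒜) (definedPreorder 𝒜 B)
bloomSuszko⇒sciModel {𝒜 = 𝒜} model a₀ = record
  { isBooleanPrealgebra = definedOps-isBooleanPrealgebra 𝒜 a₀ two
  ; isUltrafilter       = twoValued-isUltrafilter 𝒜 a₀ two
  ; f≡-TRUE             = λ x y →
      -- Normality is one direction; the reflexivity axiom for `≡′` gives the other.
      mk⇔ (IsBloomSuszkoModel.normal model) (λ { refl → f≡-refl model x })
  }
  where two = bloomSuszko⇒twoValued model

theorem3p9 : ∀ {a p r : Level} →
    (∀ {M : Set a} (TRUE : Pred M p) (ops : BooleanOps M)
    (f≡ : Op₂ M) (_⪯_ : Rel M r) →
    IsSCIModel TRUE ops f≡ _⪯_ →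
    IsBloomSuszkoModel (sciReduct ops f≡) TRUE)
    ×
    (∀ {A : Set a} (𝒜 : SCIAlgebra A) (B : Pred A p) →
    IsBloomSuszkoModel 𝒜 B →
    ∀ (a₀ : A) →
    IsSCIModel B (definedOps 𝒜 a₀) (SCIAlgebra.f≡ 𝒜) (definedPreorder 𝒜 B))
theorem3p9 = (λ _ _ _ _ → sciModel⇒bloomSuszko)
           , (λ _ _ → bloomSuszko⇒sciModel)
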